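{- Let $R$ be a ring, $P$ a polygon, $D$ a dissection of $P$, and $c:\operatorname{diag}P\to R$ a map. The following are equivalent: (i) $c$ is a weak frieze with respect to $D$; (ii) $c_{tv}\in R^*$ for every $(t,v)\in D$, and for all distinct vertices $i,k$ of $P$, \[ c_{ik}=\sum_{p\in\mathscr{P}(D,i,k)} c_p . \]
   Context: $R^*$ denotes the set of invertible elements of $R$. A polygon $P$ is a finite set $V$ of at least three vertices with a cyclic ordering, thought of as geometrically realised as a convex polygon in the plane. $\operatorname{diag}P$ is the set of ordered pairs $(i,k)$ of distinct vertices (diagonals); $(i,k)$ is an edge if $i,k$ are neighbours in the cyclic order, otherwise an internal diagonal. Diagonals $(i,k)$ and $(j,\ell)$ cross if $i,j,k,\ell$ are pairwise distinct and $i<j<k<\ell$ or $i<\ell<k<j$ in the cyclic order. A dissection of $P$ is a set $D$ of internal diagonals such that $(i,k)\in D$ implies $(k,i)\in D$, and no two diagonals in $D$ cross. We write $c_{ik}=c(i,k)$ and use the convention $c_{xx}=0$. A map $c:\operatorname{diag}P\to R$ is a weak frieze with respect to $D$ if (1) $c_{tv}\in R^*$ for all $(t,v)\in D$, and (2) whenever $(i,k)$ crosses $(t,v)$ with $(t,v),(v,t)\in D$, one has $c_{ik}=c_{it}c_{vt}^{ -1}c_{vk}+c_{iv}c_{tv}^{ -1}c_{tk}$. A sequence $(p_1,\ldots,p_\pi)$ of vertices is a $T$-path from $p_1$ to $p_\pi$ with respect to $D$ if: $p_1\neq p_\pi$; the sets $\{p_1,p_2\},\{p_2,p_3\},\ldots,\{p_{\pi-1},p_\pi\}$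 are pairwise different and each has two elements; no diagonal $(p_\alpha,p_{\alpha+1})$ crosses a diagonal in $D$; each diagonal $(p_{2\alpha},p_{2\alpha+1})$ lies in $D$ and crosses $(p_1,p_\pi)$, and these crossing points progress monotonically in the direction from $p_1$ to $p_\pi$. (Then $\pi$ is even.) $\mathscr{P}(D,i,k)$ denotes the set of $T$-paths from $i$ to $k$ with respect to $D$. For such a $T$-path $p$ (assuming $c_{tv}\in R^*$ for $(t,v)\in D$), $c_p=c_{p_1p_2}c_{p_3p_2}^{ -1}c_{p_3p_4}c_{p_5p_4}^{ -1}\cdots c_{p_{\pi-1}p_{\pi-2}}^{ -1}c_{p_{\pi-1}p_\pi}$. -}

module Defs where

open import Algebra.Bundles using (Ring)
open import Algebra.Definitions using (Invertible)
open import Data.Fin.Base using (Fin; zero; suc; toℕ; _<_; combine)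
open import Data.Fin.Properties
  using (_≟_; _<?_; all?; combine-injective; injective⇒≤)
open import Data.List.Base
  using (List; []; _∷_; [_]; _++_; allFin; cartesianProductWith; filter; foldr;
         head; last; length; lookup; map)
open import Data.List.Membership.Propositional using (_∈_)
open import Data.List.Membership.Propositional.Properties
  using (∈-allFin; ∈-lookup; ∈-cartesianProductWith⁺; ∈-cartesianProductWith⁻;
         ∈-filter⁺; ∈-filter⁻)
open import Data.List.Properties using (∷-injective; length-map)
open import Data.List.Relation.Unary.All as All using (All)
open import Data.List.Relation.Unary.AllPairs as AllPairs using (AllPairs; []; _∷_)
import Data.List.Relation.Unary.AllPairs.Properties as AllPairsₚ
open import Data.List.Relation.Unary.Any using (here; there)
open import Data.List.Relation.Unary.Unique.Propositional using (Unique)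
import Data.List.Relation.Unary.Unique.Propositional.Properties as Uniqueₚ
open import Data.Maybe.Base using (just)
open import Data.Maybe.Properties using (≡-dec)
open import Data.Nat.Base as ℕ using (ℕ; zero; suc; _≤_; z≤n; s≤s)
open import Data.Product.Base using (_×_; _,_; proj₁; proj₂; uncurry)
open import Data.Sum.Base using (_⊎_; inj₁; inj₂)
open import Level using (_⊔_)
open import Relation.Binary.PropositionalEquality
  using (_≡_; _≢_; refl; sym; trans; cong; subst)
open import Relation.Nullary.Decidable
  using (Dec; yes; no; ¬?; map′; _×-dec_; _⊎-dec_; _→-dec_)
open import Relation.Nullary.Negation using (¬_; contradiction)

------------------------------------------------------------------------
-- Polygons.  The vertices of an n-gon are the elements of Fin n, in the
-- cyclic order 0 < 1 < ⋯ < n - 1 < 0.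

module _ {n : ℕ} where

  -- i < j < k < ℓ in the cyclic order: one of the four rotations of
  -- (i , j , k , ℓ) is increasing in the linear order of Fin n.
  Cyclic : Fin n → Fin n → Fin n → Fin n → Set
  Cyclic i j k ℓ = (i < j × j < k × k < ℓ)
                 ⊎ (j < k × k < ℓ × ℓ < i)
                 ⊎ (k < ℓ × ℓ < i × i < j)
                 ⊎ (ℓ < i × i < j × j < k)

  -- (i , k) crosses (j , ℓ).  Cyclic is strict, so the four vertices are
  -- automatically pairwise distinct.
  Crosses : Fin n → Fin n → Fin n → Fin n → Set
  Crosses i k j ℓ = Cyclic i j k ℓ ⊎ Cyclic i ℓ k j

  cyclic? : ∀ i j k ℓ → Dec (Cyclic i j k ℓ)
  cyclic? i j k ℓ = (i <? j ×-dec j <? k ×-dec k <? ℓ)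
             ⊎-dec (j <? k ×-dec k <? ℓ ×-dec ℓ <? i)
             ⊎-dec (k <? ℓ ×-dec ℓ <? i ×-dec i <? j)
             ⊎-dec (ℓ <? i ×-dec i <? j ×-dec j <? k)

  crosses? : ∀ i k j ℓ → Dec (Crosses i k j ℓ)
  crosses? i k j ℓ = cyclic? i j k ℓ ⊎-dec cyclic? i ℓ k j

  Next : Fin n → Fin n → Set
  Next i k = (toℕ k ≡ suc (toℕ i)) ⊎ (suc (toℕ i) ≡ n × toℕ k ≡ 0)

  Neighbours : Fin n → Fin n → Set
  Neighbours i k = Next i k ⊎ Next k i

  InternalDiagonal : Fin n → Fin n → Set
  InternalDiagonal i k = i ≢ k × ¬ Neighbours i k

record Diag (n : ℕ) : Set where
  constructor diag
  field
    source target : Fin n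
    .distinct     : source ≢ target

-- A set of diagonals of a finite polygon is given by a decidable relation.
record Dissection (n : ℕ) : Set₁ where
  field
    Chord       : Fin n → Fin n → Set
    chord?      : ∀ t v → Dec (Chord t v)
    internal    : ∀ {t v} → Chord t v → InternalDiagonal t v
    symmetric   : ∀ {t v} → Chord t v → Chord v t
    noncrossing : ∀ {t v s u} → Chord t v → Chord s u → ¬ Crosses t v s u

------------------------------------------------------------------------
-- T-paths

steps : ∀ {a} {A : Set a} → List A → List (A × A)
steps (x ∷ xs@(y ∷ _)) = (x , y) ∷ steps xs
steps _                = []

-- The entries in positions 2, 4, 6, …, counting from 1.
evens : ∀ {a} {A : Set a} → List A → List A
evens (_ ∷ y ∷ xs) = y ∷ evens xs
evens _            = []

module _ {n : ℕ} where

  -- {a , b} = {c , d}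
  SameEdge : Fin n × Fin n → Fin n × Fin n → Set
  SameEdge (a , b) (c , d) = (a ≡ c × b ≡ d) ⊎ (a ≡ d × b ≡ c)

  -- Let (t , v) and (t′ , v′) be non-crossing diagonals, both crossing a
  -- diagonal that ends at k.  Travelling along that diagonal towards k one
  -- meets (t , v) no later than (t′ , v′) precisely when (t′ , v′) lies in the
  -- closed half of the polygon cut off by (t , v) which contains k, i.e. when
  -- (t , v) separates neither t′ nor v′ from k.
  NoLater : Fin n → Fin n × Fin n → Fin n × Fin n → Set
  NoLater k (t , v) (t′ , v′) = ¬ Crosses k t′ t v × ¬ Crosses k v′ t v

  module _ (D : Dissection n) where
    open Dissection D

    record IsTPath (i k : Fin n) (p : List (Fin n)) : Set where
      field
        starts    : head p ≡ just i
        ends      : last p ≡ just k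
        i≢k       : i ≢ k
        proper    : All (uncurry _≢_) (steps p)
        different : AllPairs (λ e f → ¬ SameEdge e f) (steps p)
        avoids    : All (λ (a , b) → ∀ t v → Chord t v → ¬ Crosses a b t v) (steps p)
        evenSteps : All (λ (t , v) → Chord t v × Crosses t v i k) (evens (steps p))
        monotone  : AllPairs (NoLater k) (evens (steps p))

    sameEdge? : ∀ e f → Dec (SameEdge e f)
    sameEdge? (a , b) (c , d) =
      (a ≟ c ×-dec b ≟ d) ⊎-dec (a ≟ d ×-dec b ≟ c)

    isTPath? : ∀ i k p → Dec (IsTPath i k p)
    isTPath? i k p = map′
      (λ (a , b , c , d , e , f , g , h) → record
        { starts = a ; ends = b ; i≢k = c ; proper = d
        ; different = e ; avoids = f ; evenSteps = g ; monotone = h })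
      (λ q → let open IsTPath q in
        starts , ends , i≢k , proper , different , avoids , evenSteps , monotone)
      (≡-dec _≟_ (head p) (just i)
        ×-dec ≡-dec _≟_ (last p) (just k)
        ×-dec ¬? (i ≟ k)
        ×-dec All.all? (λ (a , b) → ¬? (a ≟ b)) (steps p)
        ×-dec AllPairs.allPairs? (λ e f → ¬? (sameEdge? e f)) (steps p)
        ×-dec All.all? (λ (a , b) → all? λ t → all? λ v →
                          chord? t v →-dec ¬? (crosses? a b t v)) (steps p)
        ×-dec All.all? (λ (t , v) → chord? t v ×-dec crosses? t v i k)
                       (evens (steps p))
        ×-dec AllPairs.allPairs?
                (λ (t , v) (t′ , v′) → ¬? (crosses? k t′ t v) ×-dec ¬? (crosses? k v′ t v))
                (evens (steps p)))

-- The lists of length at most m.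
lists≤ : ∀ n → ℕ → List (List (Fin n))
lists≤ n zero    = [ [] ]
lists≤ n (suc m) = [] ∷ cartesianProductWith _∷_ (allFin n) (lists≤ n m)

-- All T-paths from i to k, each listed once: see ∈-tPaths⁺, ∈-tPaths⁻ and
-- tPaths-unique.  The steps of a T-path are distinct pairs of vertices, so a
-- T-path has at most n * n + 1 entries.
tPaths : ∀ {n} → Dissection n → Fin n → Fin n → List (List (Fin n))
tPaths {n} D i k = filter (isTPath? D i k) (lists≤ n (suc (n ℕ.* n)))

∈-lists≤ : ∀ {n m} (p : List (Fin n)) → length p ≤ m → p ∈ lists≤ n m
∈-lists≤ {m = zero}  []      _       = here refl
∈-lists≤ {m = suc m} []      _       = here refl
∈-lists≤ {m = suc m} (x ∷ p) (s≤s h) =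
  there (∈-cartesianProductWith⁺ _∷_ (∈-allFin x) (∈-lists≤ p h))

lists≤-unique : ∀ n m → Unique (lists≤ n m)
lists≤-unique n zero    = All.[] ∷ []
lists≤-unique n (suc m) =
  All.tabulate (λ {q} q∈ []≡q → cons≢[] (subst (_∈ _) (sym []≡q) q∈))
    ∷ Uniqueₚ.cartesianProductWith⁺ _∷_ ∷-injective
        (Uniqueₚ.allFin⁺ n) (lists≤-unique n m)
  where
  cons≢[] : ¬ ([] ∈ cartesianProductWith _∷_ (allFin n) (lists≤ n m))
  cons≢[] []∈ with ∈-cartesianProductWith⁻ _∷_ (allFin n) (lists≤ n m) []∈
  ... | _ , _ , _ , _ , ()

lookup-injective : ∀ {a} {A : Set a} {xs : List A} → Unique xs →
                   ∀ {i j} → lookup xs i ≡ lookup xs j → i ≡ j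
lookup-injective (x∉ ∷ u) {zero}  {zero}  _  = refl
lookup-injective (x∉ ∷ u) {zero}  {suc j} eq = contradiction eq (All.lookup x∉ (∈-lookup j))
lookup-injective (x∉ ∷ u) {suc i} {zero}  eq = contradiction (sym eq) (All.lookup x∉ (∈-lookup i))
lookup-injective (x∉ ∷ u) {suc i} {suc j} eq = cong suc (lookup-injective u eq)

unique⇒length≤ : ∀ {n} (xs : List (Fin n)) → Unique xs → length xs ≤ n
unique⇒length≤ xs u = injective⇒≤ {f = lookup xs} (lookup-injective u)

length-steps : ∀ {a} {A : Set a} (x : A) xs → length (steps (x ∷ xs)) ≡ length xs
length-steps x []       = refl
length-steps x (y ∷ xs) = cong suc (length-steps y xs)

module _ {n : ℕ} (D : Dissection n) {i k : Fin n} where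

  tPath-length : ∀ {p} → IsTPath D i k p → length p ≤ suc (n ℕ.* n)
  tPath-length {[]}     q = z≤n
  tPath-length {x ∷ xs} q =
    s≤s (subst (_≤ n ℕ.* n)
      (trans (length-map (uncurry combine) (steps (x ∷ xs))) (length-steps x xs))
      (unique⇒length≤ _ (AllPairsₚ.map⁺
        (AllPairs.map (λ {(a , b)} {(c , d)} e≢f eq → e≢f (inj₁ (combine-injective a b c d eq)))
          (IsTPath.different q)))))

  ∈-tPaths⁺ : ∀ {p} → IsTPath D i k p → p ∈ tPaths D i k
  ∈-tPaths⁺ {p} q = ∈-filter⁺ (isTPath? D i k) (∈-lists≤ p (tPath-length q)) q

  ∈-tPaths⁻ : ∀ {p} → p ∈ tPaths D i k → IsTPath D i k p
  ∈-tPaths⁻ p∈ = proj₂ (∈-filter⁻ (isTPath? D i k) {xs = lists≤ n (suc (n ℕ.* n))} p∈)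

  tPaths-unique : Unique (tPaths D i k)
  tPaths-unique = Uniqueₚ.filter⁺ (isTPath? D i k) (lists≤-unique n (suc (n ℕ.* n)))

------------------------------------------------------------------------
-- Weak friezes

module _ {a ℓ} (R : Ring a ℓ) {n : ℕ} (D : Dissection n)
         (c : Diag n → Ring.Carrier R) where
  open Ring R hiding (sym; trans; refl)
  open Dissection D

  -- c_{ik}, with the convention c_{xx} = 0.
  entry : Fin n → Fin n → Carrier
  entry i k with i ≟ k
  ... | yes _  = 0#
  ... | no i≢k = c (diag i k i≢k)

  InvertibleOnD : Set (a ⊔ ℓ)
  InvertibleOnD = ∀ t v → Chord t v → Invertible _≈_ 1# _*_ (entry t v)

  module _ (unit : InvertibleOnD) where

    -- The inverse of c_{tv} for (t , v) ∈ D; the value off D is never used.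
    inverse : Fin n → Fin n → Carrier
    inverse t v with chord? t v
    ... | yes tv∈D = proj₁ (unit t v tv∈D)
    ... | no _     = 0#

    -- c_p.  T-paths have even length, so the last clause is never used for them.
    weight : List (Fin n) → Carrier
    weight (x ∷ y ∷ [])        = entry x y
    weight (x ∷ y ∷ p@(z ∷ _)) = entry x y * inverse z y * weight p
    weight _                   = 0#

    tPathSum : Fin n → Fin n → Carrier
    tPathSum i k = foldr _+_ 0# (map weight (tPaths D i k))

  record IsWeakFrieze : Set (a ⊔ ℓ) where
    field
      unit     : InvertibleOnD
      exchange : ∀ i k t v → Crosses i k t v → Chord t v → Chord v t →
                 entry i k ≈ entry i t * inverse unit v t * entry v k
                           + entry i v * inverse unit t v * entry t k

{-# OPTIONS --safe #-}
module Submission where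

-- Let (a , b) be the chord of D met first when travelling from i to k, so that
-- (i , a) and (i , b) cross no chord.  A T-path from i starts with i , a or
-- i , b, and prefixing T-paths from b by i , a, with a , b , a cancelled to a, is a
-- bijection onto those starting with i , a.  On the level of sums,
--   ∑(i,k) = c(i,a) c(b,a)⁻¹ ∑(b,k) + c(i,b) c(a,b)⁻¹ ∑(a,k),
-- which is the exchange relation for (a , b).  Both implications then follow by
-- induction on the number of chords crossing (i , k): for (i) ⇒ (ii) apply the
-- exchange relation for the first chord, and for (ii) ⇒ (i) expand c(i,k),
-- c(i,t) and c(i,v) at the first chord and use the exchange relations for
-- (a , k) and (b , k).

open import Defs
open import Algebra.Bundles using (Ring)
import Algebra.Properties.CommutativeSemigroup as CommutativeSemigroupₚ
open import Data.Fin.Base using (Fin; toℕ; fromℕ<; _<_; combine; remQuot)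
open import Data.Fin.Patterns using (0F; 1F; 2F; 3F; 4F; 5F)
open import Data.Fin.Properties
  using (_≟_; _<?_; all?; any?; toℕ-fromℕ<; <-trans; <-irrefl; <-asym; <-cmp; remQuot-combine)
open import Data.Fin.Subset using (Subset; ∣_∣) renaming (_∈_ to _∈ₛ_)
open import Data.Fin.Subset.Properties using (p⊆q⇒∣p∣≤∣q∣; p⊂q⇒∣p∣<∣q∣; ∣p∣≤n)
open import Data.List.Base using (List; []; _∷_; map; _++_; last; foldr)
open import Data.List.Membership.Propositional using (_∈_)
open import Data.List.Membership.Propositional.Properties
  using (∈-map⁺; ∈-map⁻; ∈-++⁺ˡ; ∈-++⁺ʳ; ∈-++⁻)
open import Data.List.Membership.Propositional.Properties.WithK using (unique∧set⇒bag)
open import Data.List.Properties using (map-id-local; map-∘; ∷-injective)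
open import Data.List.Relation.Binary.BagAndSetEquality using (∼bag⇒↭)
open import Data.List.Relation.Binary.Permutation.Propositional using (_↭_; ↭⇒↭ₛ′)
open import Data.List.Relation.Binary.Permutation.Propositional.Properties using (map⁺)
import Data.List.Relation.Binary.Permutation.Setoid.Properties as Permutationₚ
open import Data.List.Relation.Unary.All as All using (All; []; _∷_)
open import Data.List.Relation.Unary.AllPairs using ([]; _∷_)
open import Data.List.Relation.Unary.Any using (here)
open import Data.List.Relation.Unary.Unique.Propositional using (Unique)
import Data.List.Relation.Unary.Unique.Propositional.Properties as Uniqueₚ
open import Data.Maybe.Base using (just)
open import Data.Nat.Base as ℕ using (ℕ; _≤_)
open import Data.Nat.Induction using (<-wellFounded; Acc; acc)
import Data.Nat.Properties as ℕₚ
open import Data.Product.Base using (Σ-syntax; ∃-syntax; _×_; _,_; proj₁; proj₂)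
open import Data.Sum.Base as Sum using (_⊎_; inj₁; inj₂; [_,_]′)
open import Data.Unit.Base using (⊤; tt)
open import Data.Vec.Base using (Vec; []; _∷_; lookup; tabulate)
open import Data.Vec.Properties using (lookup⇒[]=; []=⇒lookup; lookup∘tabulate)
open import Function.Base using (_∘_)
open import Function.Bundles using (_⇔_; mk⇔)
open import Level using (0ℓ)
open import Relation.Binary.Definitions using (tri<; tri≈; tri>)
open import Relation.Binary.PropositionalEquality
  using (_≡_; _≢_; refl; sym; trans; subst; subst₂)
import Relation.Binary.Reasoning.Setoid as SetoidReasoning
open import Relation.Nullary.Decidable
  using (yes; no; does; dec-true; toWitness; ¬?; _×-dec_; _⊎-dec_; _→-dec_)
open import Relation.Nullary.Negation using (¬_; contradiction)
open import Relation.Unary using (Pred; Decidable)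

-- Crossing diagonals

module _ {N : ℕ} where

  private
    subset : {P : Pred (Fin N) 0ℓ} → Decidable P → Subset N
    subset P? = tabulate (does ∘ P?)

    ∈-subset⁺ : ∀ {P : Pred (Fin N) 0ℓ} (P? : Decidable P) {x} → P x → x ∈ₛ subset P?
    ∈-subset⁺ P? {x} px =
      lookup⇒[]= x _ (trans (lookup∘tabulate (does ∘ P?) x) (dec-true (P? x) px))

    ∈-subset⁻ : ∀ {P : Pred (Fin N) 0ℓ} (P? : Decidable P) {x} → x ∈ₛ subset P? → P x
    ∈-subset⁻ P? {x} x∈ with P? x | trans (sym (lookup∘tabulate (does ∘ P?) x)) ([]=⇒lookup x∈)
    ... | yes px | _ = px

  count : {P : Pred (Fin N) 0ℓ} → Decidable P → ℕ
  count P? = ∣ subset P? ∣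

  module _ {P Q : Pred (Fin N) 0ℓ} (P? : Decidable P) (Q? : Decidable Q)
           (P⊆Q : ∀ {x} → P x → Q x) where

    count-mono-≤ : count P? ≤ count Q?
    count-mono-≤ = p⊆q⇒∣p∣≤∣q∣ (∈-subset⁺ Q? ∘ P⊆Q ∘ ∈-subset⁻ P?)

    count-mono-< : ∀ {x} → Q x → ¬ P x → count P? ℕ.< count Q?
    count-mono-< {x} qx ¬px = p⊂q⇒∣p∣<∣q∣
      (∈-subset⁺ Q? ∘ P⊆Q ∘ ∈-subset⁻ P? , x , ∈-subset⁺ Q? qx , ¬px ∘ ∈-subset⁻ P?)

  count<N : ∀ {P : Pred (Fin N) 0ℓ} (P? : Decidable P) {x} → ¬ P x → count P? ℕ.< N
  count<N P? ¬px = ℕₚ.<-≤-trans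
    (count-mono-< P? (λ _ → yes tt) (λ _ → tt) tt ¬px) (∣p∣≤n (subset {P = λ _ → ⊤} (λ _ → yes tt)))

-- Crossings depend only on the relative order of the vertices involved, so a
-- statement about m vertices of a polygon can be transported to the m-gon,
-- replacing each vertex by its rank, and be decided there.
module Ranking {m n : ℕ} (vs : Vec (Fin n) m) where

  private
    ρ : Fin m → Fin n
    ρ = lookup vs

    below? : ∀ a → Decidable (λ b → ρ b < ρ a)
    below? a b = ρ b <? ρ a

    rank<m : ∀ a → count (below? a) ℕ.< m
    rank<m a = count<N (below? a) {a} (<-irrefl refl)

  -- Counting indices with a strictly smaller entry gives equal vertices equal ranks, so
  -- coincidences survive in the m-gon. No index counts itself, which keeps the rank below `m`.
  rank : Fin m → Fin m
  rank a = fromℕ< (rank<m a)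

  private
    σ = rank

    toℕ-σ : ∀ a → toℕ (σ a) ≡ count (below? a)
    toℕ-σ a = toℕ-fromℕ< (rank<m a)

    down< : ∀ {a b} → ρ a < ρ b → σ a < σ b
    down< {a} {b} a<b = subst₂ ℕ._<_ (sym (toℕ-σ a)) (sym (toℕ-σ b))
      (count-mono-< (below? a) (below? b) (λ c<a → <-trans c<a a<b) a<b (<-irrefl refl))

    up< : ∀ {a b} → σ a < σ b → ρ a < ρ b
    up< {a} {b} a<b with ρ a <? ρ b
    ... | yes ρa<ρb = ρa<ρb
    ... | no ρa≮ρb = contradiction a<b (ℕₚ.≤⇒≯ (subst₂ _≤_ (sym (toℕ-σ b)) (sym (toℕ-σ a))
      (count-mono-≤ (below? b) (below? a) (λ c<b → ℕₚ.<-≤-trans c<b (ℕₚ.≮⇒≥ ρa≮ρb)))))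

    cyclic-map : ∀ {k l} {α : Fin m → Fin k} {β : Fin m → Fin l} →
                 (∀ {a b} → α a < α b → β a < β b) →
                 ∀ a b c d → Cyclic (α a) (α b) (α c) (α d) → Cyclic (β a) (β b) (β c) (β d)
    cyclic-map {α = α} {β} f a b c d = Sum.map f₃ (Sum.map f₃ (Sum.map f₃ f₃))
      where
      f₃ : ∀ {u v x y z w} → α u < α v × α x < α y × α z < α w → β u < β v × β x < β y × β z < β w
      f₃ (p , q , r) = f p , f q , f r

  down : ∀ a b c d → Crosses (ρ a) (ρ b) (ρ c) (ρ d) → Crosses (σ a) (σ b) (σ c) (σ d)
  down a b c d = Sum.map (cyclic-map {α = ρ} {σ} down< a c b d) (cyclic-map {α = ρ} {σ} down< a d b c)

  up : ∀ a b c d → Crosses (σ a) (σ b) (σ c) (σ d) → Crosses (ρ a) (ρ b) (ρ c) (ρ d)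
  up a b c d = Sum.map (cyclic-map {α = σ} {ρ} up< a c b d) (cyclic-map {α = σ} {ρ} up< a d b c)

  up≡ : ∀ a b → σ a ≡ σ b → ρ a ≡ ρ b
  up≡ a b eq with <-cmp (ρ a) (ρ b)
  ... | tri< lt _ _ = contradiction (down< lt) (<-irrefl eq)
  ... | tri≈ _ ρa≡ρb _ = ρa≡ρb
  ... | tri> _ _ gt = contradiction (down< gt) (<-irrefl (sym eq))

module _ {n : ℕ} where

  private variable
    a b c d i k t v x y : Fin n

  cyclic-rotate : Cyclic a b c d → Cyclic b c d a
  cyclic-rotate (inj₁ p)               = inj₂ (inj₂ (inj₂ p))
  cyclic-rotate (inj₂ (inj₁ p))        = inj₁ p
  cyclic-rotate (inj₂ (inj₂ (inj₁ p))) = inj₂ (inj₁ p)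
  cyclic-rotate (inj₂ (inj₂ (inj₂ p))) = inj₂ (inj₂ (inj₁ p))

  crosses-sym : Crosses a b c d → Crosses c d a b
  crosses-sym (inj₁ p) = inj₂ (cyclic-rotate p)
  crosses-sym (inj₂ p) = inj₁ (cyclic-rotate (cyclic-rotate (cyclic-rotate p)))

  crosses-swapʳ : Crosses a b c d → Crosses a b d c
  crosses-swapʳ = Sum.swap

  crosses-swapˡ : Crosses a b c d → Crosses b a c d
  crosses-swapˡ = crosses-sym ∘ crosses-swapʳ ∘ crosses-sym

  crosses-irreflˡ : ¬ Crosses a b a d
  crosses-irreflˡ (inj₁ (inj₁ (p , _)))                = <-irrefl refl p
  crosses-irreflˡ (inj₁ (inj₂ (inj₁ (p , q , r))))     = <-irrefl refl (<-trans p (<-trans q r))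
  crosses-irreflˡ (inj₁ (inj₂ (inj₂ (inj₁ (_ , _ , p))))) = <-irrefl refl p
  crosses-irreflˡ (inj₁ (inj₂ (inj₂ (inj₂ (_ , p , _))))) = <-irrefl refl p
  crosses-irreflˡ (inj₂ (inj₁ (p , q , r)))            = <-irrefl refl (<-trans p (<-trans q r))
  crosses-irreflˡ (inj₂ (inj₂ (inj₁ (_ , _ , p))))     = <-irrefl refl p
  crosses-irreflˡ (inj₂ (inj₂ (inj₂ (inj₁ (_ , p , _))))) = <-irrefl refl p
  crosses-irreflˡ (inj₂ (inj₂ (inj₂ (inj₂ (p , _ , _))))) = <-irrefl refl p

  crosses⇒≢₁₃ : Crosses a b c d → a ≢ c
  crosses⇒≢₁₃ cr refl = crosses-irreflˡ cr

  crosses⇒≢₂₃ : Crosses a b c d → b ≢ c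
  crosses⇒≢₂₃ = crosses⇒≢₁₃ ∘ crosses-swapˡ

  crosses⇒≢₁₄ : Crosses a b c d → a ≢ d
  crosses⇒≢₁₄ = crosses⇒≢₁₃ ∘ crosses-swapʳ

  crosses⇒≢₂₄ : Crosses a b c d → b ≢ d
  crosses⇒≢₂₄ = crosses⇒≢₂₃ ∘ crosses-swapʳ

  private
    ¬cyclic₂₄ : ¬ Cyclic a c b c
    ¬cyclic₂₄ (inj₁ (_ , p , q))               = <-asym p q
    ¬cyclic₂₄ (inj₂ (inj₁ (p , q , _)))        = <-asym p q
    ¬cyclic₂₄ (inj₂ (inj₂ (inj₁ (p , q , r)))) = <-irrefl refl (<-trans q r)
    ¬cyclic₂₄ (inj₂ (inj₂ (inj₂ (p , q , r)))) = <-irrefl refl (<-trans p q)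

  crosses⇒≢₃₄ : Crosses a b c d → c ≢ d
  crosses⇒≢₃₄ (inj₁ p) refl = ¬cyclic₂₄ p
  crosses⇒≢₃₄ (inj₂ p) refl = ¬cyclic₂₄ p

  -- Separation by non-crossing diagonals

  private
    opaque
      -- These facts are decided by running through all tuples of vertices. Hypotheses stand before
      -- the quantifiers over the remaining vertices, which cuts the search short.
      noLater₅ : ∀ (a b v k : Fin 5) → Crosses a b v k →
                 ∀ t → ¬ Crosses t v a b → ¬ Crosses k a t v
      noLater₅ = toWitness {a? = all? λ a → all? λ b → all? λ v → all? λ k →
        crosses? a b v k →-dec all? λ t → ¬? (crosses? t v a b) →-dec ¬? (crosses? k a t v)} _

      extend₆ : ∀ (t v i k : Fin 6) → Crosses t v i k →
                ∀ a b → ¬ Crosses t v a b → Crosses a b v k → Crosses a b i k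
      extend₆ = toWitness {a? = all? λ t → all? λ v → all? λ i → all? λ k →
        crosses? t v i k →-dec all? λ a → all? λ b →
        ¬? (crosses? t v a b) →-dec crosses? a b v k →-dec crosses? a b i k} _

      restrict₆ : ∀ (t v i k : Fin 6) → Crosses t v i k →
                  ∀ a b → Crosses a b i k → ¬ Crosses k a t v → ¬ Crosses k b t v →
                  a ≢ v → b ≢ v → Crosses a b v k
      restrict₆ = toWitness {a? = all? λ t → all? λ v → all? λ i → all? λ k →
        crosses? t v i k →-dec all? λ a → all? λ b →
        crosses? a b i k →-dec ¬? (crosses? k a t v) →-dec ¬? (crosses? k b t v) →-dec
        ¬? (a ≟ v) →-dec ¬? (b ≟ v) →-dec crosses? a b v k} _

      beyond₆ : ∀ (a b i k : Fin 6) → Crosses a b i k →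
                ∀ x y → Crosses x y i k → ¬ Crosses a b x y →
                ¬ Crosses x y i a → ¬ Crosses x y i b → x ≡ a ⊎ x ≡ b ⊎ Crosses a b i x
      beyond₆ = toWitness {a? = all? λ a → all? λ b → all? λ i → all? λ k →
        crosses? a b i k →-dec all? λ x → all? λ y →
        crosses? x y i k →-dec ¬? (crosses? a b x y) →-dec
        ¬? (crosses? x y i a) →-dec ¬? (crosses? x y i b) →-dec
        (x ≟ a ⊎-dec x ≟ b ⊎-dec crosses? a b i x)} _

      plane₅ : ∀ (a b x z : Fin 5) → Crosses a b x z →
               ∀ y → y ≢ a → y ≢ b → Crosses a b x y ⊎ Crosses a b y z
      plane₅ = toWitness {a? = all? λ a → all? λ b → all? λ x → all? λ z →
        crosses? a b x z →-dec all? λ y → ¬? (y ≟ a) →-dec ¬? (y ≟ b) →-dec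
        (crosses? a b x y ⊎-dec crosses? a b y z)} _

  -- Since (a , b) separates v from k and does not cross (t , v), the latter lies in the closed half
  -- containing v, whereas (k , a) and (k , b) lie in the other half.
  crosses⇒noLater : ¬ Crosses t v a b → Crosses a b v k → NoLater k (t , v) (a , b)
  crosses⇒noLater {t} {v} {a} {b} {k} nc cr = lem nc cr , lem (nc ∘ crosses-swapʳ) (crosses-swapˡ cr)
    where
    lem : ∀ {a b} → ¬ Crosses t v a b → Crosses a b v k → ¬ Crosses k a t v
    lem {a} {b} nc cr = noLater₅ _ _ _ _ (down 2F 3F 1F 4F cr) _ (nc ∘ up 0F 1F 2F 3F) ∘ down 4F 2F 0F 1F
      where open Ranking (t ∷ v ∷ a ∷ b ∷ k ∷ [])

  -- As before, a and b lie on the closed side of (t , v) containing k. On the other side (a , b)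
  -- cannot separate i from v, so it cuts off i from k together with v.
  crosses-extend : Crosses t v i k → ¬ Crosses t v a b → Crosses a b v k → Crosses a b i k
  crosses-extend {t} {v} {i} {k} {a} {b} tv nc ab =
    up 4F 5F 2F 3F (extend₆ _ _ _ _ (down 0F 1F 2F 3F tv) _ _ (nc ∘ up 0F 1F 4F 5F) (down 4F 5F 1F 3F ab))
    where open Ranking (t ∷ v ∷ i ∷ k ∷ a ∷ b ∷ [])

  -- A converse to `crosses-extend`: `NoLater` puts a and b in the closed half of (t , v) containing
  -- k, so (a , b) cannot cross (i , v). As v is not on it, v stays on the side of i.
  crosses-restrict : Crosses t v i k → Crosses a b i k → NoLater k (t , v) (a , b) →
                     a ≢ v → b ≢ v → Crosses a b v k
  crosses-restrict {t} {v} {i} {k} {a} {b} tv ab (na , nb) a≢v b≢v =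
    up 4F 5F 1F 3F (restrict₆ _ _ _ _ (down 0F 1F 2F 3F tv) _ _ (down 4F 5F 2F 3F ab)
      (na ∘ up 3F 4F 0F 1F) (nb ∘ up 3F 5F 0F 1F) (a≢v ∘ up≡ 4F 1F) (b≢v ∘ up≡ 5F 1F))
    where open Ranking (t ∷ v ∷ i ∷ k ∷ a ∷ b ∷ [])

  -- Were x strictly on the side of i, then y would be in the same closed half of (a , b), and (x ,
  -- y), crossing (i , k), would cut off i from a or from b.
  endpoint-or-beyond : Crosses a b i k → Crosses x y i k → ¬ Crosses a b x y →
                       ¬ Crosses x y i a → ¬ Crosses x y i b → x ≡ a ⊎ x ≡ b ⊎ Crosses a b i x
  endpoint-or-beyond {a} {b} {i} {k} {x} {y} ab xy nc na nb =
    Sum.map (up≡ 4F 0F) (Sum.map (up≡ 4F 1F) (up 0F 1F 2F 4F))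
      (beyond₆ _ _ _ _ (down 0F 1F 2F 3F ab) _ _ (down 4F 5F 2F 3F xy)
        (nc ∘ up 0F 1F 4F 5F) (na ∘ up 4F 5F 2F 0F) (nb ∘ up 4F 5F 2F 1F))
    where open Ranking (a ∷ b ∷ i ∷ k ∷ x ∷ y ∷ [])

  -- A vertex y off (a , b) lies on one of its two sides, hence is separated from k or from x.
  plane-separation : Crosses a b x k → y ≢ a → y ≢ b → Crosses a b x y ⊎ Crosses a b y k
  plane-separation {a} {b} {x} {k} {y} ab y≢a y≢b =
    Sum.map (up 0F 1F 2F 4F) (up 0F 1F 4F 3F)
      (plane₅ _ _ _ _ (down 0F 1F 2F 3F ab) _ (y≢a ∘ up≡ 4F 0F) (y≢b ∘ up≡ 4F 1F))
    where open Ranking (a ∷ b ∷ x ∷ k ∷ y ∷ [])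

-- T-paths

-- Applying `g` to the image gives back `xs`, and a list with a repetition-free image has no
-- repetitions itself. Hence a left inverse on the entries suffices.
Unique-map : ∀ {a b} {A : Set a} {B : Set b} {f : A → B} {g : B → A} {xs} →
             All (λ x → g (f x) ≡ x) xs → Unique xs → Unique (map f xs)
Unique-map {f = f} {g} {xs} gf≡id u =
  Uniqueₚ.map⁻ (subst Unique (trans (sym (map-id-local gf≡id)) (map-∘ {g = g} {f} xs)) u)

unique∧set⇒↭ : ∀ {a} {A : Set a} {xs ys : List A} → Unique xs → Unique ys →
               (∀ {x} → x ∈ xs → x ∈ ys) → (∀ {x} → x ∈ ys → x ∈ xs) → xs ↭ ys
unique∧set⇒↭ xs! ys! xs⊆ys ys⊆xs = ∼bag⇒↭ (unique∧set⇒bag xs! ys! (mk⇔ xs⊆ys ys⊆xs))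

All-steps : ∀ {a p} {A : Set a} {P : Pred A p} {xs} → All P xs → All (λ (x , y) → P x × P y) (steps xs)
All-steps []               = []
All-steps (px ∷ [])        = []
All-steps (px ∷ py ∷ pxs)  = (px , py) ∷ All-steps (py ∷ pxs)

module _ {n : ℕ} (D : Dissection n) where
  open Dissection D

  private variable
    a b i k t v w x y z : Fin n
    p q r : List (Fin n)

  -- Chords crossing a diagonal, and the first of them

  Avoids : Fin n → Fin n → Set
  Avoids a b = ∀ t v → Chord t v → ¬ Crosses a b t v

  chord-avoids : Chord t v → Avoids t v
  chord-avoids tv _ _ = noncrossing tv

  avoids? : ∀ a b → Avoids a b ⊎ (∃[ t ] ∃[ v ] Chord t v × Crosses t v a b)
  avoids? a b with any? (λ t → any? (λ v → chord? t v ×-dec crosses? t v a b))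
  ... | yes cr = inj₂ cr
  ... | no ¬cr = inj₁ (λ t v tv cr → ¬cr (t , v , tv , crosses-sym cr))

  private
    CrossingChord : Fin n → Fin n → Fin (n ℕ.* n) → Set
    CrossingChord i k e = let (t , v) = remQuot n e in Chord t v × Crosses t v i k

    crossingChord? : ∀ i k → Decidable (CrossingChord i k)
    crossingChord? i k e = let (t , v) = remQuot n e in chord? t v ×-dec crosses? t v i k

  opaque
    crossings : Fin n → Fin n → ℕ
    crossings i k = count (crossingChord? i k)

    crossings-sym : ∀ i k → crossings i k ℕ.≤ crossings k i
    crossings-sym i k = count-mono-≤ (crossingChord? i k) (crossingChord? k i)
      (λ (tv , cr) → tv , crosses-swapʳ cr)

    -- By `crosses-extend` no new chord is met from v. The drop is strict because (t , v) itself
    -- crosses (i , k) but shares the endpoint v with (v , k).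
    crossings-< : Chord t v → Crosses t v i k → crossings v k ℕ.< crossings i k
    crossings-< {t} {v} {i} {k} tv cr =
      count-mono-< (crossingChord? v k) (crossingChord? i k)
        (λ (ab , cr′) → ab , crosses-extend cr (noncrossing tv ab) cr′)
        {combine t v}
        (subst (λ (t , v) → Chord t v × Crosses t v i k) (sym (remQuot-combine t v)) (tv , cr))
        λ (_ , cr′) → crosses⇒≢₂₃
          (subst (λ (t , u) → Crosses t u v k) (remQuot-combine t v) cr′) refl

  -- (a , b) is the chord met first when travelling from i to k.
  record FirstChord (i k a b : Fin n) : Set where
    field
      chord   : Chord a b
      crosses : Crosses a b i k
      avoidsˡ : Avoids i a
      avoidsʳ : Avoids i b

  flip-first : FirstChord i k a b → FirstChord i k b a
  flip-first f = record
    { chord = symmetric chord ; crosses = crosses-swapˡ crosses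
    ; avoidsˡ = avoidsʳ ; avoidsʳ = avoidsˡ }
    where open FirstChord f

  -- Take any chord (t , v) crossing (i , k). If (i , t) or (i , v) is still crossed, it is crossed
  -- by fewer chords, and its first chord is also one for (i , k).
  firstChord? : ∀ i k → Avoids i k ⊎ (∃[ a ] ∃[ b ] FirstChord i k a b)
  firstChord? i k = search i k (<-wellFounded _)
    where
    search : ∀ i k → Acc ℕ._<_ (crossings i k) → Avoids i k ⊎ (∃[ a ] ∃[ b ] FirstChord i k a b)
    search i k (acc rec) with avoids? i k
    ... | inj₁ av = inj₁ av
    ... | inj₂ (t , v , tv , cr) =
      [ (λ avˡ → [ (λ avʳ → inj₂ (t , v , record
                      { chord = tv ; crosses = cr ; avoidsˡ = avˡ ; avoidsʳ = avʳ }))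
                 , inj₂ ∘ widen tv cr ]′
                 (search i v (rec (shorter tv cr))))
      , inj₂ ∘ widen (symmetric tv) (crosses-swapˡ cr) ]′
      (search i t (rec (shorter (symmetric tv) (crosses-swapˡ cr))))
      where
      shorter : ∀ {t v} → Chord t v → Crosses t v i k → crossings i v ℕ.< crossings i k
      -- `crossings-<` moves the source of a diagonal; moving the target requires reversing the
      -- diagonal before and after.
      shorter {v = v} tv cr = ℕₚ.≤-<-trans (crossings-sym i v)
        (ℕₚ.<-≤-trans (crossings-< tv (crosses-swapʳ cr)) (crossings-sym k i))

      widen : ∀ {t v} → Chord t v → Crosses t v i k →
              (∃[ a ] ∃[ b ] FirstChord i v a b) → ∃[ a ] ∃[ b ] FirstChord i k a b
      widen tv cr (a , b , f) = a , b , record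
        { FirstChord f
        ; crosses = crosses-swapʳ (crosses-extend (crosses-swapʳ cr) (noncrossing tv (FirstChord.chord f))
                      (crosses-swapʳ (FirstChord.crosses f))) }

  first-induction : ∀ {ℓ} {k} (P : Fin n → Set ℓ) →
                    (∀ {i} → Avoids i k → P i) →
                    (∀ {i a b} → FirstChord i k a b → P a → P b → P i) →
                    ∀ i → P i
  first-induction {k = k} P base peel i = go i (<-wellFounded _)
    where
    go : ∀ i → Acc ℕ._<_ (crossings i k) → P i
    go i (acc rec) with firstChord? i k
    ... | inj₁ av = base av
    ... | inj₂ (a , b , f) = peel f (go a (rec (crossings-< (symmetric chord) (crosses-swapˡ crosses))))
                                    (go b (rec (crossings-< chord crosses)))
      where open FirstChord f

  -- T-paths described recursively: the remainder of a T-path after its first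
  -- chord (x , y) is a T-path from y.  Monotonicity and most of the
  -- distinctness of the steps follow.
  data TPath (k : Fin n) : Fin n → List (Fin n) → Set where
    direct : i ≢ k → Avoids i k → TPath k i (i ∷ k ∷ [])
    step   : Avoids i x → Chord x y → Crosses x y i k → x ≢ z →
             TPath k y (y ∷ z ∷ r) → TPath k i (i ∷ x ∷ y ∷ z ∷ r)

  tPath-ends≢ : TPath k i p → i ≢ k
  tPath-ends≢ (direct i≢k _)      = i≢k
  tPath-ends≢ (step _ _ cr _ _)   = crosses⇒≢₃₄ cr

  tPath-last≡ : TPath k i (x ∷ r) → last (x ∷ r) ≡ just k
  tPath-last≡ (direct _ _)       = refl
  tPath-last≡ (step _ _ _ _ tp)  = tPath-last≡ tp

  -- The invariant of the vertices after the first on a T-path. It excludes i, since a chord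
  -- crossing (i , k) has no endpoint there, so the path never returns to its start.
  Visits : (i k w : Fin n) → Set
  Visits i k w = w ≡ k ⊎ (∃[ u ] Chord w u × Crosses w u i k)

  visits-extend : Chord x y → Crosses x y i k → Visits y k w → Visits i k w
  visits-extend xy cr = Sum.map₂ (λ (u , wu , cr′) → u , wu , crosses-extend cr (noncrossing xy wu) cr′)

  tPath-visits : TPath k i (i ∷ q) → All (Visits i k) q
  tPath-visits (direct _ _)         = inj₁ refl ∷ []
  tPath-visits (step _ xy cr _ tp)  =
    inj₂ (_ , xy , cr) ∷ inj₂ (_ , symmetric xy , crosses-swapˡ cr) ∷
    All.map (visits-extend xy cr) (tPath-visits tp)

  visits⇒≢ : i ≢ k → Visits i k w → i ≢ w
  visits⇒≢ i≢k (inj₁ refl)         = i≢k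
  visits⇒≢ i≢k (inj₂ (_ , _ , cr)) = crosses⇒≢₁₃ cr ∘ sym

  ∉-steps : All (x ≢_) q → All (λ e → ¬ SameEdge (x , y) e × ¬ SameEdge (y , x) e) (steps q)
  ∉-steps x∉q = All.map
    (λ (x≢a , x≢b) → (λ { (inj₁ (eq , _)) → x≢a eq ; (inj₂ (eq , _)) → x≢b eq })
                   , (λ { (inj₁ (_ , eq)) → x≢b eq ; (inj₂ (_ , eq)) → x≢a eq }))
    (All-steps x∉q)

  TPath⇒IsTPath : TPath k i p → IsTPath D i k p
  TPath⇒IsTPath (direct i≢k av) = record
    { starts = refl ; ends = refl ; i≢k = i≢k ; proper = i≢k ∷ [] ; different = [] ∷ []
    ; avoids = av ∷ [] ; evenSteps = [] ; monotone = [] }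
  TPath⇒IsTPath {k} {i} (step {x = x} {y} {z} {r} av xy cr x≢z tp) = record
    { starts    = refl
    ; ends      = tPath-last≡ tp
    ; i≢k       = i≢k
    ; proper    = crosses⇒≢₁₃ cr ∘ sym ∷ x≢y ∷ proper
    -- Neither i nor y recurs later, so edges could coincide only in neighbouring steps; these are
    -- told apart by x ≢ y, i ≢ y and x ≢ z.
    ; different = (ix≁xy ∷ All.map proj₁ (∉-steps i∉)) ∷
                  (xy≁yz ∷ All.map proj₂ (∉-steps y∉)) ∷ different
    ; avoids    = av ∷ chord-avoids xy ∷ avoids
    ; evenSteps = (xy , cr) ∷ All.map
                    (λ (ab , cr′) → ab , crosses-extend cr (noncrossing xy ab) cr′) evenSteps
    ; monotone  = All.map (λ (ab , cr′) → crosses⇒noLater (noncrossing xy ab) cr′) evenSteps ∷ monotone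
    }
    where
    open IsTPath (TPath⇒IsTPath tp) hiding (i≢k)
    i≢k = crosses⇒≢₃₄ cr
    i≢y = crosses⇒≢₂₃ cr ∘ sym
    x≢y : x ≢ y
    x≢y = proj₁ (internal xy)
    y∉ : All (y ≢_) (z ∷ r)
    y∉ = All.map (visits⇒≢ (tPath-ends≢ tp)) (tPath-visits tp)
    i∉ : All (i ≢_) (y ∷ z ∷ r)
    i∉ = i≢y ∷ All.map (visits⇒≢ i≢k ∘ visits-extend xy cr) (tPath-visits tp)
    ix≁xy : ¬ SameEdge (i , x) (x , y)
    ix≁xy (inj₁ (_ , eq)) = x≢y eq
    ix≁xy (inj₂ (eq , _)) = i≢y eq
    xy≁yz : ¬ SameEdge (x , y) (y , z)
    xy≁yz (inj₁ (eq , _)) = x≢y eq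
    xy≁yz (inj₂ (eq , _)) = x≢z eq

  -- Monotonicity after (x , y) allows `crosses-restrict` once y is not an endpoint. For the next
  -- chord (z , w) this comes from properness and from {y , z} ≠ {z , w}. For later ones, (z , w)
  -- separates y from k but none of their endpoints from k.
  remainder-evenSteps : IsTPath D i k (i ∷ x ∷ y ∷ z ∷ r) →
    All (λ (t , v) → Chord t v × Crosses t v y k) (evens (steps (y ∷ z ∷ r)))
  remainder-evenSteps {r = []} _ = []
  remainder-evenSteps {i} {k} {x} {y} {z} {w ∷ r} q
    with IsTPath.proper q | IsTPath.different q | IsTPath.evenSteps q | IsTPath.monotone q
  ... | _ ∷ _ ∷ y≢z ∷ _ | _ ∷ _ ∷ (yz≁zw ∷ _) ∷ _
      | (_ , xy) ∷ (zw , zw×) ∷ later | (nl ∷ nls) ∷ nls′ ∷ _ =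
    (zw , zw×y) ∷ All.map restrict (All.zip (later , All.zip (nls , nls′)))
    where
    zw×y : Crosses z w y k
    zw×y = crosses-restrict xy zw× nl (y≢z ∘ sym) (λ w≡y → yz≁zw (inj₂ (sym w≡y , refl)))
    ≢y : ¬ Crosses k t z w → t ≢ y
    ≢y nc refl = nc (crosses-swapˡ (crosses-sym zw×y))
    restrict : ∀ {e} → (Chord (proj₁ e) (proj₂ e) × Crosses (proj₁ e) (proj₂ e) i k) ×
                       NoLater k (x , y) e × NoLater k (z , w) e →
               Chord (proj₁ e) (proj₂ e) × Crosses (proj₁ e) (proj₂ e) y k
    restrict ((ab , ab×) , nl , (na , nb)) = ab , crosses-restrict xy ab× nl (≢y na) (≢y nb)

  IsTPath⇒TPath : ∀ p → IsTPath D i k p → TPath k i p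
  IsTPath⇒TPath [] record { starts = () }
  IsTPath⇒TPath (i ∷ []) record { starts = refl ; ends = refl ; i≢k = i≢k } = contradiction refl i≢k
  IsTPath⇒TPath (i ∷ x ∷ []) record { starts = refl ; ends = refl ; i≢k = i≢k ; avoids = av ∷ _ } =
    direct i≢k av
  -- This excludes odd length: the final step would be a chord that ends at k and yet crosses (i ,
  -- k).
  IsTPath⇒TPath (i ∷ x ∷ y ∷ []) record { starts = refl ; ends = refl ; evenSteps = (_ , cr) ∷ _ } =
    contradiction refl (crosses⇒≢₂₄ cr)
  IsTPath⇒TPath (i ∷ x ∷ y ∷ z ∷ r) q@record
    { starts = refl ; ends = ends ; proper = _ ∷ _ ∷ proper
    ; different = _ ∷ (xy≁yz ∷ _) ∷ different ; avoids = av ∷ _ ∷ avoids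
    ; evenSteps = (xy , cr) ∷ _ ; monotone = _ ∷ monotone } =
    step av xy cr (λ x≡z → xy≁yz (inj₂ (x≡z , refl))) (IsTPath⇒TPath (y ∷ z ∷ r) record
      { starts = refl ; ends = ends ; i≢k = crosses⇒≢₂₄ cr ; proper = proper
      ; different = different ; avoids = avoids
      ; evenSteps = remainder-evenSteps q ; monotone = monotone })

  -- Opaque, to keep the enumeration of all lists from being unfolded.
  opaque
    paths : Fin n → Fin n → List (List (Fin n))
    paths = tPaths D

    paths≡tPaths : ∀ i k → paths i k ≡ tPaths D i k
    paths≡tPaths i k = refl

    ∈-paths⁺ : TPath k i p → p ∈ paths i k
    ∈-paths⁺ = ∈-tPaths⁺ D ∘ TPath⇒IsTPath

    ∈-paths⁻ : p ∈ paths i k → TPath k i p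
    ∈-paths⁻ = IsTPath⇒TPath _ ∘ ∈-tPaths⁻ D

    paths-unique : ∀ i k → Unique (paths i k)
    paths-unique i k = tPaths-unique D

  paths-avoids : i ≢ k → Avoids i k → paths i k ↭ (i ∷ k ∷ []) ∷ []
  paths-avoids {i} {k} i≢k av = unique∧set⇒↭ (paths-unique i k) ([] ∷ [])
    (only ∘ ∈-paths⁻) (λ { (here refl) → ∈-paths⁺ (direct i≢k av) })
    where
    only : TPath k i p → p ∈ (i ∷ k ∷ []) ∷ []
    only (direct _ _)          = here refl
    only (step _ xy cr _ _)    = contradiction (crosses-sym cr) (av _ _ xy)

  -- The T-path from i obtained from a T-path q from b, when (a , b) is the
  -- first chord: prefix i, a to q, and cancel if q itself starts with b, a.
  graft : Fin n → Fin n → List (Fin n) → List (Fin n)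
  graft i a (b ∷ z ∷ r) with z ≟ a
  ... | yes _ = i ∷ z ∷ r
  ... | no _  = i ∷ a ∷ b ∷ z ∷ r
  graft i a r = i ∷ a ∷ r

  -- A left inverse of `graft i a` on T-paths from b: the third vertex of the result is b exactly
  -- when nothing was cancelled.
  prune : Fin n → List (Fin n) → List (Fin n)
  prune b (_ ∷ x ∷ y ∷ r) with y ≟ b
  ... | yes _ = y ∷ r
  ... | no _  = b ∷ x ∷ y ∷ r
  prune b r = r

  module _ (f : FirstChord i k a b) where
    open FirstChord f

    private
      a≢k : a ≢ k
      a≢k = crosses⇒≢₁₄ crosses

    -- The graph of `graft i a` on T-paths from b, carrying in each case the data that make the
    -- result a T-path from i.
    data Grafted : List (Fin n) → List (Fin n) → Set where
      cancel : Chord a y → Crosses a y b k → a ≢ z → TPath k y (y ∷ z ∷ r) →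
               Grafted (b ∷ a ∷ y ∷ z ∷ r) (i ∷ a ∷ y ∷ z ∷ r)
      prefix : a ≢ z → TPath k b (b ∷ z ∷ r) → Grafted (b ∷ z ∷ r) (i ∷ a ∷ b ∷ z ∷ r)

    grafted : TPath k b q → Grafted q (graft i a q)
    grafted (direct b≢k av) with k ≟ a
    ... | yes k≡a = contradiction (sym k≡a) a≢k
    ... | no k≢a = prefix (k≢a ∘ sym) (direct b≢k av)
    grafted tp@(step {x = x} _ xy cr x≢z tp′) with x ≟ a
    ... | yes refl = cancel xy cr x≢z tp′
    ... | no x≢a = prefix (x≢a ∘ sym) tp

    graft-tPath : TPath k b q → TPath k i (graft i a q)
    graft-tPath {q} tp with graft i a q | grafted tp
    ... | _ | cancel ay cr a≢z tp′ = step avoidsˡ ay (crosses-extend crosses (noncrossing chord ay) cr) a≢z tp′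
    ... | _ | prefix a≢z tp′       = step avoidsˡ chord crosses a≢z tp′

    prune-graft : TPath k b q → prune b (graft i a q) ≡ q
    prune-graft {q} tp with graft i a q | grafted tp
    ... | _ | cancel {y = y} _ cr _ _ with y ≟ b
    ...   | yes y≡b = contradiction y≡b (crosses⇒≢₂₃ cr)
    ...   | no _ = refl
    prune-graft {q} tp | _ | prefix _ _ with b ≟ b
    ...   | yes _ = refl
    ...   | no b≢b = contradiction refl b≢b

    graft-second : TPath k b q → ∃[ r ] graft i a q ≡ i ∷ a ∷ r
    graft-second {q} tp with graft i a q | grafted tp
    ... | _ | cancel _ _ _ _ = _ , refl
    ... | _ | prefix _ _     = _ , refl

    -- If y is b, drop the prefix. Otherwise put b in place of i: (a , y) separates i from k, and (i
    -- , b) crosses no chord, so b is on the side of i and (a , y) crosses (b , k).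
    graft-surjective : Chord a y → Crosses a y i k → a ≢ z → TPath k y (y ∷ z ∷ r) →
                       ∃[ q ] TPath k b q × i ∷ a ∷ y ∷ z ∷ r ≡ graft i a q
    graft-surjective {y} {z} {r} ay cr a≢z tp with y ≟ b
    ... | yes refl = _ , tp , eq
      where
      eq : i ∷ a ∷ b ∷ z ∷ r ≡ graft i a (b ∷ z ∷ r)
      eq with z ≟ a
      ... | yes z≡a = contradiction (sym z≡a) a≢z
      ... | no _    = refl
    ... | no y≢b = _ , step (chord-avoids (symmetric chord)) ay ay×bk a≢z tp , eq
      where
      ay×bk : Crosses a y b k
      ay×bk = [ (λ c → contradiction (crosses-sym c) (avoidsʳ _ _ ay)) , (λ c → c) ]′
                (plane-separation cr (proj₁ (internal chord) ∘ sym) (y≢b ∘ sym))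
      eq : i ∷ a ∷ y ∷ z ∷ r ≡ graft i a (b ∷ a ∷ y ∷ z ∷ r)
      eq with a ≟ a
      ... | yes _   = refl
      ... | no a≢a = contradiction refl a≢a

  first-endpoint-or-beyond : FirstChord i k a b → Chord x y → Crosses x y i k →
                             x ≡ a ⊎ x ≡ b ⊎ Crosses a b i x
  first-endpoint-or-beyond f xy cr = endpoint-or-beyond crosses cr (noncrossing chord xy)
    (avoidsˡ _ _ xy ∘ crosses-sym) (avoidsʳ _ _ xy ∘ crosses-sym)
    where open FirstChord f

  -- The two families are disjoint because their second vertices are a and b. They exhaust all
  -- T-paths: a second vertex beyond (a , b) would make the first step cross that chord.
  paths-first : FirstChord i k a b →
    paths i k ↭ map (graft i a) (paths b k) ++ map (graft i b) (paths a k)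
  paths-first {i} {k} {a} {b} f = unique∧set⇒↭ {ys = xs ++ ys} (paths-unique i k)
    (Uniqueₚ.++⁺ (unique f) (unique f′) disjoint)
    (λ p∈ → split (∈-paths⁻ p∈))
    (λ p∈ → [ join f , join f′ ]′ (∈-++⁻ xs p∈))
    where
    f′ = flip-first f
    xs = map (graft i a) (paths b k)
    ys = map (graft i b) (paths a k)
    open FirstChord f

    unique : ∀ {a b} → FirstChord i k a b → Unique (map (graft i a) (paths b k))
    unique {a} {b} f = Unique-map {f = graft i a} {g = prune b} {xs = paths b k}
      (All.tabulate (λ q∈ → prune-graft f (∈-paths⁻ q∈))) (paths-unique b k)

    join : ∀ {a b} → FirstChord i k a b → p ∈ map (graft i a) (paths b k) → p ∈ paths i k
    join {a = a} f p∈ with ∈-map⁻ (graft i a) p∈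
    ... | q , q∈ , refl = ∈-paths⁺ (graft-tPath f (∈-paths⁻ q∈))

    disjoint : ¬ (p ∈ xs × p ∈ ys)
    disjoint (p∈ , p∈′) with ∈-map⁻ (graft i a) p∈ | ∈-map⁻ (graft i b) p∈′
    ... | q , q∈ , eq | q′ , q∈′ , eq′ =
      proj₁ (internal chord) (proj₁ (∷-injective (proj₂ (∷-injective
        (trans (sym (trans eq (proj₂ (graft-second f (∈-paths⁻ q∈)))))
               (trans eq′ (proj₂ (graft-second f′ (∈-paths⁻ q∈′)))))))))

    through : ∀ {a b} → (f : FirstChord i k a b) → Chord a y → Crosses a y i k → a ≢ z →
              TPath k y (y ∷ z ∷ r) → i ∷ a ∷ y ∷ z ∷ r ∈ map (graft i a) (paths b k)
    through {a = a} {b} f ay cr a≢z tp with graft-surjective f ay cr a≢z tp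
    ... | q , tq , eq = subst (_∈ map (graft i a) (paths b k)) (sym eq) (∈-map⁺ (graft i a) (∈-paths⁺ tq))

    split : TPath k i p → p ∈ xs ++ ys
    split (direct _ av) = contradiction (crosses-sym crosses) (av _ _ chord)
    split (step av xy cr x≢z tp) with first-endpoint-or-beyond f xy cr
    ... | inj₁ refl        = ∈-++⁺ˡ (through f xy cr x≢z tp)
    ... | inj₂ (inj₁ refl) = ∈-++⁺ʳ xs (through f′ xy cr x≢z tp)
    ... | inj₂ (inj₂ cr′)  = contradiction (crosses-sym cr′) (av _ _ chord)

-- Friezes

module _ {a ℓ} (R : Ring a ℓ) {n : ℕ} (D : Dissection n)
         (c : Diag n → Ring.Carrier R) (unit : InvertibleOnD R D c) where
  open Ring R renaming (refl to ≈-refl; sym to ≈-sym; trans to ≈-trans)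
  open Dissection D
  open SetoidReasoning setoid
  open CommutativeSemigroupₚ +-commutativeSemigroup using (interchange)

  private
    variable
      i k t v x y : Fin n
      p q : List (Fin n)

    e : Fin n → Fin n → Carrier
    e = entry R D c

    inv : Fin n → Fin n → Carrier
    inv = inverse R D c unit

    w : List (Fin n) → Carrier
    w = weight R D c unit

    ∑ : List (List (Fin n)) → Carrier
    ∑ ps = foldr _+_ 0# (map w ps)

  entry-diagonal : ∀ i → e i i ≈ 0#
  entry-diagonal i with i ≟ i
  ... | yes _   = ≈-refl
  ... | no i≢i = contradiction refl i≢i

  inverseˡ : Chord t v → inv t v * e t v ≈ 1#
  inverseˡ {t} {v} tv with chord? t v
  ... | yes tv′ = proj₁ (proj₂ (unit t v tv′))
  ... | no ¬tv  = contradiction tv ¬tv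

  inverseʳ : Chord t v → e t v * inv t v ≈ 1#
  inverseʳ {t} {v} tv with chord? t v
  ... | yes tv′ = proj₂ (proj₂ (unit t v tv′))
  ... | no ¬tv  = contradiction tv ¬tv

  ∑-↭ : ∀ {ps qs} → ps ↭ qs → ∑ ps ≈ ∑ qs
  ∑-↭ ps↭qs = Permutationₚ.foldr-commMonoid setoid +-isCommutativeMonoid
    (↭⇒↭ₛ′ isEquivalence (map⁺ w ps↭qs))

  ∑-++ : ∀ ps qs → ∑ (ps ++ qs) ≈ ∑ ps + ∑ qs
  ∑-++ []       qs = ≈-sym (+-identityˡ _)
  ∑-++ (p ∷ ps) qs = ≈-trans (+-congˡ (∑-++ ps qs)) (≈-sym (+-assoc _ _ _))

  ∑-map-* : ∀ s {f ps} → All (λ p → w (f p) ≈ s * w p) ps → ∑ (map f ps) ≈ s * ∑ ps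
  ∑-map-* s []       = ≈-sym (zeroʳ s)
  ∑-map-* s (h ∷ hs) = ≈-trans (+-cong h (∑-map-* s hs)) (≈-sym (distribˡ s _ _))

  -- When b, a is cancelled, the new factor `inv b a` meets the `e b a` that opens the weight of
  -- `q`. Otherwise this is the recursion defining the weight.
  weight-graft : ∀ {a b} → FirstChord D i k a b → TPath D k b q →
                 w (graft D i a q) ≈ e i a * inv b a * w q
  weight-graft {i} {k} {q} {a} {b} f tp with graft D i a q | grafted D f tp
  ... | _ | prefix _ _ = ≈-refl
  ... | _ | cancel {y = y} {z = z} {r = r} _ _ _ _ = ≈-sym (begin
    e i a * inv b a * (e b a * inv y a * W)   ≈⟨ *-congˡ (*-assoc _ _ _) ⟩
    e i a * inv b a * (e b a * (inv y a * W)) ≈⟨ *-assoc _ _ _ ⟨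
    e i a * inv b a * e b a * (inv y a * W)   ≈⟨ *-congʳ (*-assoc _ _ _) ⟩
    e i a * (inv b a * e b a) * (inv y a * W) ≈⟨ *-congʳ (*-congˡ (inverseˡ (symmetric chord))) ⟩
    e i a * 1# * (inv y a * W)                ≈⟨ *-congʳ (*-identityʳ _) ⟩
    e i a * (inv y a * W)                     ≈⟨ *-assoc _ _ _ ⟨
    e i a * inv y a * W                       ∎)
    where
    open FirstChord f
    W = w (y ∷ z ∷ r)

  tPathSum-avoids : i ≢ k → Avoids D i k → tPathSum R D c unit i k ≈ e i k
  tPathSum-avoids {i} {k} i≢k av rewrite sym (paths≡tPaths D i k) =
    ≈-trans (∑-↭ (paths-avoids D i≢k av)) (+-identityʳ _)

  tPathSum-first : ∀ {a b} → FirstChord D i k a b →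
    tPathSum R D c unit i k ≈ e i a * inv b a * tPathSum R D c unit b k
                            + e i b * inv a b * tPathSum R D c unit a k
  tPathSum-first {i} {k} {a} {b} f
    rewrite sym (paths≡tPaths D i k) | sym (paths≡tPaths D a k) | sym (paths≡tPaths D b k) = begin
    ∑ (paths D i k)
      ≈⟨ ∑-↭ (paths-first D f) ⟩
    ∑ (map (graft D i a) (paths D b k) ++ map (graft D i b) (paths D a k))
      ≈⟨ ∑-++ (map (graft D i a) (paths D b k)) _ ⟩
    ∑ (map (graft D i a) (paths D b k)) + ∑ (map (graft D i b) (paths D a k))
      ≈⟨ +-cong (∑-graft f) (∑-graft (flip-first D f)) ⟩
    e i a * inv b a * ∑ (paths D b k) + e i b * inv a b * ∑ (paths D a k) ∎
    where
    ∑-graft : ∀ {a b} → FirstChord D i k a b →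
              ∑ (map (graft D i a) (paths D b k)) ≈ e i a * inv b a * ∑ (paths D b k)
    ∑-graft f = ∑-map-* _ (All.tabulate (λ q∈ → weight-graft f (∈-paths⁻ D q∈)))

  -- Posed for arbitrary vertices, because the induction reaches diagonals sharing an endpoint with
  -- (t , v).
  record Exchange (i k t v : Fin n) : Set ℓ where
    constructor exchange
    field
      relation : e i k ≈ e i t * inv v t * e v k + e i v * inv t v * e t k

  open Exchange

  exchange-swap : Exchange i k v t → Exchange i k t v
  exchange-swap (exchange ex) = exchange (≈-trans ex (+-comm _ _))

  -- The degenerate relation rests on the convention c(t,t) = 0: one term vanishes, and in the other
  -- c(t,v) cancels its inverse.
  exchange-source : Chord t v → Exchange t k t v
  exchange-source {t} {v} {k} tv = exchange (≈-sym (begin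
    e t t * inv v t * e v k + e t v * inv t v * e t k
      ≈⟨ +-cong (*-congʳ (*-congʳ (entry-diagonal t))) (*-congʳ (inverseʳ tv)) ⟩
    0# * inv v t * e v k + 1# * e t k ≈⟨ +-cong (*-congʳ (zeroˡ _)) (*-identityˡ _) ⟩
    0# * e v k + e t k                ≈⟨ +-congʳ (zeroˡ _) ⟩
    0# + e t k                        ≈⟨ +-identityˡ _ ⟩
    e t k                             ∎))

  exchange-target : Chord v t → Exchange i t t v
  exchange-target {v} {t} {i} vt = exchange (≈-sym (begin
    e i t * inv v t * e v t + e i v * inv t v * e t t
      ≈⟨ +-cong (*-assoc _ _ _) (*-congˡ (entry-diagonal t)) ⟩
    e i t * (inv v t * e v t) + e i v * inv t v * 0#
      ≈⟨ +-cong (*-congˡ (inverseˡ vt)) (zeroʳ _) ⟩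
    e i t * 1# + 0#                   ≈⟨ +-identityʳ _ ⟩
    e i t * 1#                        ≈⟨ *-identityʳ _ ⟩
    e i t                             ∎))

  -- Expand c(i,k) along (a , b), then c(a,k) and c(b,k) along (t , v), and regroup into c(i,t) and
  -- c(i,v). Coefficients of the first expansion stay on the left and those of the second on the
  -- right, as a noncommutative ring demands.
  exchange-compose : ∀ {a b} → Exchange i k a b → Exchange i t a b → Exchange i v a b →
                     Exchange a k t v → Exchange b k t v → Exchange i k t v
  exchange-compose {i} {k} {t} {v} {a} {b} ik it iv ak bk = exchange (begin
    e i k
      ≈⟨ relation ik ⟩
    α * e b k + β * e a k
      ≈⟨ +-cong (expand bk) (expand ak) ⟩
    (α * e b t * μ + α * e b v * ν) + (β * e a t * μ + β * e a v * ν)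
      ≈⟨ interchange _ _ _ _ ⟩
    (α * e b t * μ + β * e a t * μ) + (α * e b v * ν + β * e a v * ν)
      ≈⟨ +-cong (distribʳ _ _ _) (distribʳ _ _ _) ⟨
    (α * e b t + β * e a t) * μ + (α * e b v + β * e a v) * ν
      ≈⟨ +-cong (*-congʳ (relation it)) (*-congʳ (relation iv)) ⟨
    e i t * μ + e i v * ν
      ≈⟨ +-cong (*-assoc _ _ _) (*-assoc _ _ _) ⟨
    e i t * inv v t * e v k + e i v * inv t v * e t k ∎)
    where
    α = e i a * inv b a
    β = e i b * inv a b
    μ = inv v t * e v k
    ν = inv t v * e t k
    expand : ∀ {γ x} → Exchange x k t v → γ * e x k ≈ γ * e x t * μ + γ * e x v * ν
    expand {γ} {x} xk = begin
      γ * e x k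
        ≈⟨ *-congˡ (relation xk) ⟩
      γ * (e x t * inv v t * e v k + e x v * inv t v * e t k)
        ≈⟨ *-congˡ (+-cong (*-assoc _ _ _) (*-assoc _ _ _)) ⟩
      γ * (e x t * μ + e x v * ν)
        ≈⟨ distribˡ _ _ _ ⟩
      γ * (e x t * μ) + γ * (e x v * ν)
        ≈⟨ +-cong (*-assoc _ _ _) (*-assoc _ _ _) ⟨
      γ * e x t * μ + γ * e x v * ν ∎

  -- The two implications

  TPathFormula : Set ℓ
  TPathFormula = ∀ i k → i ≢ k → e i k ≈ tPathSum R D c unit i k

  exchange⇒formula : (∀ i k t v → Crosses i k t v → Chord t v → Chord v t → Exchange i k t v) →
                     TPathFormula
  exchange⇒formula ex i k = first-induction D {k = k}
    (λ i → i ≢ k → e i k ≈ tPathSum R D c unit i k)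
    (λ av i≢k → ≈-sym (tPathSum-avoids i≢k av))
    peel i
    where
    peel : ∀ {i a b} → FirstChord D i k a b →
           (a ≢ k → e a k ≈ tPathSum R D c unit a k) →
           (b ≢ k → e b k ≈ tPathSum R D c unit b k) →
           i ≢ k → e i k ≈ tPathSum R D c unit i k
    peel {i} {a} {b} f ha hb _ = begin
      e i k
        ≈⟨ relation (ex i k a b (crosses-sym crosses) chord (symmetric chord)) ⟩
      e i a * inv b a * e b k + e i b * inv a b * e a k
        ≈⟨ +-cong (*-congˡ (hb (crosses⇒≢₂₄ crosses))) (*-congˡ (ha (crosses⇒≢₁₄ crosses))) ⟩
      e i a * inv b a * tPathSum R D c unit b k + e i b * inv a b * tPathSum R D c unit a k
        ≈⟨ tPathSum-first f ⟨
      tPathSum R D c unit i k ∎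
      where open FirstChord f

  module _ (formula : TPathFormula) where

    exchange-first : ∀ {a b} → FirstChord D i k a b → Exchange i k a b
    exchange-first {i} {k} {a} {b} f = exchange (begin
      e i k                   ≈⟨ formula i k (crosses⇒≢₃₄ crosses) ⟩
      tPathSum R D c unit i k ≈⟨ tPathSum-first f ⟩
      e i a * inv b a * tPathSum R D c unit b k + e i b * inv a b * tPathSum R D c unit a k
        ≈⟨ +-cong (*-congˡ (formula b k (crosses⇒≢₂₄ crosses)))
                  (*-congˡ (formula a k (crosses⇒≢₁₄ crosses))) ⟨
      e i a * inv b a * e b k + e i b * inv a b * e a k ∎)
      where open FirstChord f

    -- Either t is an endpoint of (a , b), a degenerate case, or t lies beyond it and (a , b) is the
    -- first chord towards t as well.
    exchange-at-chord : ∀ {a b} → FirstChord D i k a b → Chord t v → Crosses t v i k →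
                        Exchange i t a b
    exchange-at-chord f tv cr with first-endpoint-or-beyond D f tv cr
    ... | inj₁ refl        = exchange-target (symmetric (FirstChord.chord f))
    ... | inj₂ (inj₁ refl) = exchange-swap (exchange-target (FirstChord.chord f))
    ... | inj₂ (inj₂ ab)   = exchange-first (record { FirstChord f ; crosses = ab })

    -- The source x varies while k, t and v stay fixed; x remains in the closed half cut off by (t ,
    -- v) away from k until it reaches t or v.
    formula⇒exchange : Chord t v → Crosses t v i k → Exchange i k t v
    formula⇒exchange {t} {v} {i} {k} tv cr =
      first-induction D (λ x → Before x → Exchange x k t v) base peel i (inj₂ (inj₂ cr))
      where
      vt = symmetric tv

      Before : Fin n → Set
      Before x = x ≡ t ⊎ x ≡ v ⊎ Crosses t v x k

      base : ∀ {x} → Avoids D x k → Before x → Exchange x k t v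
      base _  (inj₁ refl)        = exchange-source tv
      base _  (inj₂ (inj₁ refl)) = exchange-swap (exchange-source vt)
      base av (inj₂ (inj₂ cr))   = contradiction (crosses-sym cr) (av _ _ tv)

      -- A diagonal that crosses no chord cannot leave this half: (t , v) does not separate y from
      -- x, so it separates y from k unless y is t or v.
      before : ∀ {x y} → Crosses t v x k → Avoids D x y → Before y
      before {y = y} cr av with y ≟ t | y ≟ v
      ... | yes y≡t | _       = inj₁ y≡t
      ... | no _    | yes y≡v = inj₂ (inj₁ y≡v)
      ... | no y≢t  | no y≢v  = inj₂ (inj₂
        ([ (λ cr′ → contradiction (crosses-sym cr′) (av _ _ tv)) , (λ cr′ → cr′) ]′
          (plane-separation cr y≢t y≢v)))

      peel : ∀ {x a b} → FirstChord D x k a b → (Before a → Exchange a k t v) →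
             (Before b → Exchange b k t v) → Before x → Exchange x k t v
      peel _ _  _  (inj₁ refl)        = exchange-source tv
      peel _ _  _  (inj₂ (inj₁ refl)) = exchange-swap (exchange-source vt)
      peel f ha hb (inj₂ (inj₂ cr))   = exchange-compose
        (exchange-first f)
        (exchange-at-chord f tv cr)
        (exchange-at-chord f vt (crosses-swapˡ cr))
        (ha (before cr (FirstChord.avoidsˡ f)))
        (hb (before cr (FirstChord.avoidsʳ f)))

theoremB : ∀ {a ℓ} (R : Ring a ℓ) (n : ℕ) → 3 ≤ n →
    (D : Dissection n) (c : Diag n → Ring.Carrier R) →
    IsWeakFrieze R D c
    ⇔ (Σ[ unit ∈ InvertibleOnD R D c ]
    ((i k : Fin n) → i ≢ k →
    Ring._≈_ R (entry R D c i k) (tPathSum R D c unit i k)))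
theoremB R n _ D c = mk⇔
  (λ wf → let open IsWeakFrieze wf renaming (exchange to relation) in
    unit , exchange⇒formula R D c unit λ i k t v cr tv vt → exchange (relation i k t v cr tv vt))
  (λ (unit , formula) → record
    { unit     = unit
    ; exchange = λ _ _ _ _ cr tv _ → Exchange.relation (formula⇒exchange R D c unit formula tv (crosses-sym cr)) })
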